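{- Let $N\ge 3$, let $\pi_{a,b}(k)=ak^2+bk \pmod N$ be a normalized quadratic permutation polynomial (QPP) over $\mathbb Z_N$, let $u\in\mathbb Z$ with $\gcd(u,N)=1$, and let $q\in\mathbb Z$. Then the sequence $y_{u,q}^{a,b}(k)=z_{u,q,N}(\pi_{a,b}(k))$, $k\in\mathbb Z_N$, is equivalent to a Zadoff--Chu sequence (is Zadoff--Chu-equivalent) if and only if, for each prime power $p^\alpha\Vert N$ (with $p$ a prime dividing $N$), $$\nu_p(a)\ge \eta(p,\alpha),$$ where $$\eta(p,\alpha)=\begin{cases}0,& p=2,\ \alpha=1,\\ \alpha-1,& p=2,\ \alpha\ge 2,\\ \alpha-1,& p=3,\\ \alpha,& p>3.\end{cases}$$
   Context: Write $\mathbb Z_N=\mathbb Z/N\mathbb Z$, $\zeta_N=\exp(-\pi\sqrt{ -1}/N)$, $W_N=\zeta_N^2=\exp(-2\pi\sqrt{ -1}/N)$, and $\varepsilon_N=N\bmod 2\in\{0,1\}$. For $u\in\mathbb Z$ with $\gcd(u,N)=1$ and $q\in\mathbb Z$, the length-$N$ Zadoff--Chu sequence is $z_{u,q,N}(t)=\zeta_N^{u(t+\varepsilon_N+2q)t}$; this depends only on $t$ modulo $N$, so it is a function on $\mathbb Z_N$. A normalized QPP over $\mathbb Z_N$ is a polynomial $\pi_{a,b}(X)=aX^2+bX$ with $a,b\in\mathbb Z_N$ (zero constant term; $a=0$ allowed) such that $k\mapsto \pi_{a,b}(k)$ is a permutation of $\mathbb Z_N$. Equivalence is under the five operations on sequences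 $s:\mathbb Z_N\to\mathbb C$: $s(k)\mapsto c\,s(k)$ with $|c|=1$; $s(k)\mapsto s(k+d)$ with $d\in\mathbb Z_N$; $s(k)\mapsto s(rk)$ with $r\in\mathbb Z_N^\times$; $s(k)\mapsto W_N^{\lambda k}s(k)$ with $\lambda\in\mathbb Z_N$; $s(k)\mapsto\overline{s(k)}$. Equivalently, a sequence $s$ on $\mathbb Z_N$ is Zadoff--Chu-equivalent if there exist $\sigma\in\{\pm1\}$, $r\in\mathbb Z_N^\times$, $d,\lambda\in\mathbb Z_N$, $u'$ coprime to $N$, $q'$, and a unimodular constant $c$ such that $s(k)=c\,W_N^{\lambda k}\,\zeta_N^{\sigma u'(rk+d+\varepsilon_N+2q')(rk+d)}$ for all $k\in\mathbb Z_N$. $p^\alpha\Vert N$ means $p^\alpha\mid N$ and $p^{\alpha+1}\nmid N$. $\nu_p$ is the $p$-adic valuation, $\nu_p(0)=\infty$. For a residue class $a$ modulo $N$ with $p^\alpha\Vert N$ and $0\le t\le\alpha$, $\nu_p(a)\ge t$ means that the image of $a$ in $\mathbb Z_{p^\alpha}$ is divisible by $p^t$; in particular $\nu_p(a)\ge\alpha$ means $a\equiv 0\pmod{p^\alpha}$. -}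

module Defs where

open import Algebra.Bundles using (CommutativeRing; Semiring)
import Algebra.Definitions as AlgebraDefinitions
import Algebra.Definitions.RawSemiring as RawSemiringDefinitions
open import Algebra.Morphism.Structures using (module RingMorphisms)
open import Data.Fin.Base using (Fin; toℕ)
open import Data.Integer.Base as ℤ using (ℤ; +_; -[1+_]; 1ℤ)
open import Data.Integer.GCD using (gcd)
open import Data.Nat.Base using (ℕ; suc; _+_; _*_; _^_; _∸_; _<_; _%_; NonZero)
open import Data.Nat.Divisibility using (_∣_; _∤_)
open import Data.Nat.DivMod using (_mod_)
open import Data.Nat.Primality using (Prime; prime⇒nonZero)
open import Data.Nat.Properties using (m^n≢0)
open import Data.Product.Base using (_×_; ∃-syntax)
open import Function.Definitions using (Bijective)
open import Level using (_⊔_) renaming (suc to lsuc)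
open import Relation.Binary.Construct.Closure.Equivalence using (EqClosure)
open import Relation.Binary.PropositionalEquality.Core using (_≡_)
open import Relation.Nullary.Negation.Core using (¬_)

-- Residue classes modulo N are elements of Fin N. Ring operations are computed
-- on the representatives toℕ and reduced by _mod_.

module _ {N : ℕ} .{{_ : NonZero N}} where

  infixl 6 _⊕_
  infixl 7 _⊗_

  _⊕_ : Fin N → Fin N → Fin N
  x ⊕ y = (toℕ x + toℕ y) mod N

  _⊗_ : Fin N → Fin N → Fin N
  x ⊗ y = (toℕ x * toℕ y) mod N

  IsUnit : Fin N → Set
  IsUnit r = ∃[ r′ ] r ⊗ r′ ≡ 1 mod N

  π : Fin N → Fin N → Fin N → Fin N
  π a b k = a ⊗ (k ⊗ k) ⊕ b ⊗ k

  IsQPP : Fin N → Fin N → Set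
  IsQPP a b = Bijective _≡_ _≡_ (π a b)

_^_∥_ : ℕ → ℕ → ℕ → Set
p ^ α ∥ N = (p ^ α) ∣ N × (p ^ suc α) ∤ N

-- ν_p(a) ≥ t, read in ℤ/p^α: the image of a there is p^t times some class.
-- Meaningful for p^α ∥ N and t ≤ α.

Valuation≥ : ∀ {N p} → Prime p → (α : ℕ) → Fin N → ℕ → Set
Valuation≥ {p = p} p-prime α a t =
  ∃[ c ] toℕ a mod (p ^ α) ≡ ((p ^ t) mod (p ^ α)) ⊗ c
  where instance
    _ = prime⇒nonZero p-prime
    _ = m^n≢0 p α

η : ℕ → ℕ → ℕ
η 2 1 = 0
η 2 α = α ∸ 1
η 3 α = α ∸ 1
η _ α = α

-- A commutative ring with an involutive automorphism, standing for ℂ with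
-- complex conjugation.

record InvolutiveRing c ℓ : Set (lsuc (c ⊔ ℓ)) where
  field
    commutativeRing : CommutativeRing c ℓ
  open CommutativeRing commutativeRing public
    using (Carrier; _≈_; 1#; rawRing; semiring)
    renaming (_*_ to _·_)
  open RingMorphisms rawRing rawRing using (IsRingHomomorphism)
  open AlgebraDefinitions _≈_ using (Involutive)
  field
    conj                    : Carrier → Carrier
    conj-isRingHomomorphism : IsRingHomomorphism conj
    conj-involutive         : Involutive conj

  open RawSemiringDefinitions (Semiring.rawSemiring semiring) public
    using () renaming (_^_ to _^ⁿ_)

  -- |x| = 1
  Unimodular : Carrier → Set ℓ
  Unimodular x = x · conj x ≈ 1#

  IsPrimitiveRoot : ℕ → Carrier → Set ℓ
  IsPrimitiveRoot n x =
    x ^ⁿ n ≈ 1# × (∀ m → 0 < m → m < n → ¬ (x ^ⁿ m ≈ 1#))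

  -- Integer powers of a unimodular x, whose inverse is conj x.
  infixr 8 _^ᶻ_
  _^ᶻ_ : Carrier → ℤ → Carrier
  x ^ᶻ (+ n)    = x ^ⁿ n
  x ^ᶻ -[1+ n ] = conj x ^ⁿ suc n

-- ζ stands for ζ_N = exp(-πi/N), a unimodular primitive 2N-th root of unity.

module ZadoffChu {c ℓ} (R : InvolutiveRing c ℓ) (N : ℕ) .{{_ : NonZero N}}
                 (ζ : InvolutiveRing.Carrier R) where
  open InvolutiveRing R

  W : Carrier
  W = ζ ^ⁿ 2

  Sequence : Set c
  Sequence = Fin N → Carrier

  -- The exponent is evaluated at the representative of t in {0,…,N-1}; the
  -- value depends only on t modulo N because ζ has order 2N.
  z : ℤ → ℤ → Sequence
  z u q t = ζ ^ᶻ (u ℤ.* (+ toℕ t ℤ.+ + (N % 2) ℤ.+ + 2 ℤ.* q) ℤ.* + toℕ t)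

  y : ℤ → ℤ → Fin N → Fin N → Sequence
  y u q a b k = z u q (π a b k)

  data Operation (s s′ : Sequence) : Set (c ⊔ ℓ) where
    scale     : ∀ x → Unimodular x → (∀ k → s′ k ≈ x · s k) → Operation s s′
    shift     : ∀ d → (∀ k → s′ k ≈ s (k ⊕ d)) → Operation s s′
    decimate  : ∀ r → IsUnit r → (∀ k → s′ k ≈ s (r ⊗ k)) → Operation s s′
    modulate  : ∀ (l : Fin N) → (∀ k → s′ k ≈ W ^ⁿ (toℕ l * toℕ k) · s k) →
                Operation s s′
    conjugate : (∀ k → s′ k ≈ conj (s k)) → Operation s s′

  Equivalent : Sequence → Sequence → Set (c ⊔ ℓ)
  Equivalent = EqClosure Operation

  IsZCEquivalent : Sequence → Set (c ⊔ ℓ)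
  IsZCEquivalent s =
    ∃[ u ] ∃[ q ] gcd u (+ N) ≡ 1ℤ × Equivalent (z u q) s

{-# OPTIONS --safe #-}

module Submission where

-- Let ε = N mod 2 and c = ε + 2q. Up to a unimodular factor, a Zadoff–Chu sequence is
-- ζ^(A k² + B k) with B ≡ A N (mod 2), and the five operations preserve this shape. The exponent
-- of y is u (P² + c P) with P = a k² + b k, and it is determined modulo 2N. If it agrees with a
-- quadratic, its third differences vanish modulo 2N, which gives N ∣ 6ua(a + b); as π is
-- injective modulo every divisor of N, a + b is prime to N, hence N ∣ 6a. Conversely, if N ∣ 6a,
-- the congruences k⁴ ≡ k² (mod 12) and k³ ≡ k (mod 6) reduce the exponent to the quadratic with
-- A = u (a² + b² + c a), which is prime to N, and B = u (2ab + c b). Finally N ∣ 6a is what the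
-- conditions ν_p(a) ≥ η(p, α) say prime by prime.

open import Defs
open import Algebra.Bundles using (CommutativeMonoid; CommutativeRing)
open import Algebra.Morphism.Structures using (module RingMorphisms)
import Algebra.Properties.CommutativeSemigroup as CommutativeSemigroupProperties
import Algebra.Properties.Semiring.Exp as Exp
open import Data.Fin.Base using (Fin; toℕ; punchOut)
open import Data.Fin.Properties
  using (any?; injective⇒≤; punchOut-injective; toℕ-fromℕ<; toℕ-injective; toℕ<n)
  renaming (_≟_ to _≟ᶠ_)
open import Data.Integer.Base as ℤ using (ℤ; +_; -[1+_]; 0ℤ; 1ℤ; _+_; _*_; _-_; -_)
import Data.Integer.Coprimality as ℤ
import Data.Integer.DivMod as ℤ
open import Data.Integer.Divisibility.Signed
open import Data.Integer.GCD using (gcd)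
import Data.Integer.Properties as ℤ
open import Data.Integer.Tactic.RingSolver using (solve-∀)
open import Data.List.Base using ([]; _∷_)
open import Data.List.Relation.Unary.All using ([]; _∷_)
open import Data.Nat.Base as ℕ using (ℕ; zero; suc; z≤n; s≤s; _≤_; NonZero)
import Data.Nat.Coprimality as ℕ
import Data.Nat.DivMod as ℕ
open import Data.Nat.DivMod using (_mod_)
import Data.Nat.Divisibility as ℕ
import Data.Nat.GCD as ℕ
open import Data.Nat.ListAction using (product)
open import Data.Nat.Primality
  using (Prime; prime?; prime[2]; ¬prime[0]; ¬prime[1]; euclidsLemma;
         prime⇒irreducible; prime⇒nonTrivial; prime⇒nonZero)
open import Data.Nat.Primality.Factorisation using (factorise)
import Data.Nat.Properties as ℕ
open import Data.Product using (_×_; _,_; ∃-syntax; proj₁; proj₂)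
open import Data.Sum.Base as Sum using (_⊎_; inj₁; inj₂)
open import Function.Bundles using (_⇔_; mk⇔)
open import Function.Definitions using (Injective; StrictlySurjective)
open import Level using (_⊔_)
open import Relation.Binary.Construct.Closure.ReflexiveTransitive using (ε; _◅_)
open import Relation.Binary.Construct.Closure.Symmetric using (fwd; bwd)
open import Relation.Binary.PropositionalEquality
  using (_≡_; _≢_; refl; sym; trans; cong; cong₂; subst; module ≡-Reasoning)
import Relation.Binary.Reasoning.Setoid as SetoidReasoning
open import Relation.Nullary.Decidable using (from-no; from-yes; yes; no)
open import Relation.Nullary.Negation.Core using (¬_; contradiction)

private variable
  d i j k l m n : ℤ

-- Divisibility of polynomial values by 2, 6 and 12.

2∣n²+n : ∀ n → + 2 ∣ + n * + n + + n
2∣n²+n zero = divides 0ℤ refl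
2∣n²+n (suc n) =
  subst (+ 2 ∣_) (lemma (+ n)) (∣m∣n⇒∣m+n (2∣n²+n n) (∣m⇒∣m*n (+ 1 + + n) ∣-refl))
  where
  lemma : ∀ n → n * n + n + + 2 * (+ 1 + n) ≡ (+ 1 + n) * (+ 1 + n) + (+ 1 + n)
  lemma = solve-∀

2∣i²+i : ∀ i → + 2 ∣ i * i + i
2∣i²+i (+ n)    = 2∣n²+n n
2∣i²+i -[1+ n ] = subst (+ 2 ∣_) (lemma (+ n)) (2∣n²+n n)
  where
  lemma : ∀ n → n * n + n ≡ (- (+ 1 + n)) * (- (+ 1 + n)) - (+ 1 + n)
  lemma = solve-∀

-- Passing from n to n + 1 adds 3 (n² + n), and n² + n is even.
6∣n³-n : ∀ n → + 6 ∣ + n * + n * + n - + n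
6∣n³-n zero = divides 0ℤ refl
6∣n³-n (suc n) =
  subst (+ 6 ∣_) (lemma (+ n))
    (∣m∣n⇒∣m+n (6∣n³-n n) (*-monoʳ-∣ (+ 3) (2∣n²+n n)))
  where
  lemma : ∀ n → n * n * n - n + + 3 * (n * n + n) ≡
                (+ 1 + n) * (+ 1 + n) * (+ 1 + n) - (+ 1 + n)
  lemma = solve-∀

-- Passing from n to n + 1 adds 4 (n³ - n) + 6 (n² + n), where 6 divides n³ - n and 2 divides n² +
-- n.
12∣n⁴-n² : ∀ n → + 12 ∣ + n * + n * (+ n * + n) - + n * + n
12∣n⁴-n² zero = divides 0ℤ refl
12∣n⁴-n² (suc n) =
  subst (+ 12 ∣_) (lemma (+ n))
    (∣m∣n⇒∣m+n (12∣n⁴-n² n)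
      (∣m∣n⇒∣m+n (∣n⇒∣m*n (+ 2) (*-monoʳ-∣ (+ 2) (6∣n³-n n)))
                 (*-monoʳ-∣ (+ 6) (2∣n²+n n))))
  where
  lemma : ∀ n → n * n * (n * n) - n * n +
                (+ 2 * (+ 2 * (n * n * n - n)) + + 6 * (n * n + n)) ≡
                (+ 1 + n) * (+ 1 + n) * ((+ 1 + n) * (+ 1 + n)) - (+ 1 + n) * (+ 1 + n)
  lemma = solve-∀

-- Congruences of integers and residue classes.

infix 4 _≋_[_]

-- A record rather than a synonym for `m ∣ i - j`, so that `i` and `j` can be recovered from the
-- type by unification.
record _≋_[_] (i j m : ℤ) : Set where
  constructor from-∣
  field to-∣ : m ∣ i - j

open _≋_[_]

≡⇒≋ : i ≡ j → i ≋ j [ m ]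
≡⇒≋ {i} refl = from-∣ (divides 0ℤ (ℤ.+-inverseʳ i))

≋-refl : i ≋ i [ m ]
≋-refl = ≡⇒≋ refl

≋-sym : i ≋ j [ m ] → j ≋ i [ m ]
≋-sym {i} {j} (from-∣ p) = from-∣ (subst (_ ∣_) (lemma i j) (∣m⇒∣-m p))
  where
  lemma : ∀ i j → - (i - j) ≡ j - i
  lemma = solve-∀

≋-trans : i ≋ j [ m ] → j ≋ k [ m ] → i ≋ k [ m ]
≋-trans {i} {j} {k = k} (from-∣ p) (from-∣ q) =
  from-∣ (subst (_ ∣_) (lemma i j k) (∣m∣n⇒∣m+n p q))
  where
  lemma : ∀ i j k → i - j + (j - k) ≡ i - k
  lemma = solve-∀

+-cong-≋ : i ≋ j [ m ] → k ≋ l [ m ] → i + k ≋ j + l [ m ]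
+-cong-≋ {i} {j} {k = k} {l} (from-∣ p) (from-∣ q) =
  from-∣ (subst (_ ∣_) (lemma i j k l) (∣m∣n⇒∣m+n p q))
  where
  lemma : ∀ i j k l → i - j + (k - l) ≡ i + k - (j + l)
  lemma = solve-∀

*-cong-≋ : i ≋ j [ m ] → k ≋ l [ m ] → i * k ≋ j * l [ m ]
*-cong-≋ {i} {j} {k = k} {l} (from-∣ p) (from-∣ q) =
  from-∣ (subst (_ ∣_) (lemma i j k l) (∣m∣n⇒∣m+n (∣m⇒∣m*n k p) (∣n⇒∣m*n j q)))
  where
  lemma : ∀ i j k l → (i - j) * k + j * (k - l) ≡ i * k - j * l
  lemma = solve-∀

≋-weaken : d ∣ m → i ≋ j [ m ] → i ≋ j [ d ]
≋-weaken d∣m (from-∣ p) = from-∣ (∣-trans d∣m p)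

∣-resp-≋ : i ≋ j [ d ] → d ∣ i → d ∣ j
∣-resp-≋ {i} {j} (from-∣ p) q = subst (_ ∣_) (lemma i j) (∣m∣n⇒∣m-n q p)
  where
  lemma : ∀ i j → i - (i - j) ≡ j
  lemma = solve-∀

i+j-i≡j : ∀ i j → i + j - i ≡ j
i+j-i≡j = solve-∀

%-≋ : ∀ k n .{{_ : NonZero n}} → + (k ℕ.% n) ≋ + k [ + n ]
%-≋ k n = ≋-sym (from-∣ (divides (+ (k ℕ./ n)) (begin
  + k - + (k ℕ.% n)
    ≡⟨ cong (λ x → + x - + (k ℕ.% n)) (ℕ.m≡m%n+[m/n]*n k n) ⟩
  + (k ℕ.% n) + + ((k ℕ./ n) ℕ.* n) - + (k ℕ.% n)
    ≡⟨ i+j-i≡j (+ (k ℕ.% n)) (+ ((k ℕ./ n) ℕ.* n)) ⟩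
  + ((k ℕ./ n) ℕ.* n)  ≡⟨ ℤ.pos-* (k ℕ./ n) n ⟩
  + (k ℕ./ n) * + n    ∎)))
  where
  open ≡-Reasoning

⟦_⟧ : ∀ {n} → Fin n → ℤ
⟦ i ⟧ = + toℕ i

⟦mod⟧ : ∀ k n .{{_ : NonZero n}} → ⟦ k mod n ⟧ ≋ + k [ + n ]
⟦mod⟧ k n = subst (λ r → + r ≋ + k [ + n ]) (sym (toℕ-fromℕ< (ℕ.m%n<n k n))) (%-≋ k n)

fromℤ : ∀ n .{{_ : NonZero n}} → ℤ → Fin n
fromℤ n i = (i ℤ.%ℕ n) mod n

⟦fromℤ⟧ : ∀ n .{{_ : NonZero n}} i → ⟦ fromℤ n i ⟧ ≋ i [ + n ]
⟦fromℤ⟧ n i = ≋-trans (⟦mod⟧ (i ℤ.%ℕ n) n) (≋-sym (from-∣ (divides (i ℤ./ℕ n) (begin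
  i - + (i ℤ.%ℕ n)
    ≡⟨ cong (_- + (i ℤ.%ℕ n)) (ℤ.a≡a%ℕn+[a/ℕn]*n i n) ⟩
  + (i ℤ.%ℕ n) + (i ℤ./ℕ n) * + n - + (i ℤ.%ℕ n)
    ≡⟨ i+j-i≡j (+ (i ℤ.%ℕ n)) ((i ℤ./ℕ n) * + n) ⟩
  (i ℤ./ℕ n) * + n  ∎))))
  where
  open ≡-Reasoning

-- Two representatives in {0,...,n-1} differ by less than n in absolute value, so a difference
-- divisible by n is zero.
⟦⟧-injective-≋ : ∀ {n} (i j : Fin n) → ⟦ i ⟧ ≋ ⟦ j ⟧ [ + n ] → i ≡ j
⟦⟧-injective-≋ {n} i j p with ℤ.∣ ⟦ i ⟧ - ⟦ j ⟧ ∣ in eq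
... | zero  = toℕ-injective (ℤ.+-injective (ℤ.i-j≡0⇒i≡j ⟦ i ⟧ ⟦ j ⟧ (ℤ.∣i∣≡0⇒i≡0 eq)))
... | suc r = contradiction (subst (n ℕ.∣_) eq (∣⇒∣ᵤ (to-∣ p))) (ℕ.>⇒∤ r<n)
  where
  r<n : suc r ℕ.< n
  r<n = subst (ℕ._< n) (trans (cong ℤ.∣_∣ (sym (ℤ.m-n≡m⊖n (toℕ i) (toℕ j)))) eq)
          (ℕ.≤-<-trans (ℤ.∣m⊝n∣≤m⊔n (toℕ i) (toℕ j)) (ℕ.⊔-lub (toℕ<n i) (toℕ<n j)))

⟦⊕⟧ : ∀ {N} .{{_ : NonZero N}} (x y : Fin N) → ⟦ x ⊕ y ⟧ ≋ ⟦ x ⟧ + ⟦ y ⟧ [ + N ]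
⟦⊕⟧ {N} x y = ⟦mod⟧ (toℕ x ℕ.+ toℕ y) N

⟦⊗⟧ : ∀ {N} .{{_ : NonZero N}} (x y : Fin N) → ⟦ x ⊗ y ⟧ ≋ ⟦ x ⟧ * ⟦ y ⟧ [ + N ]
⟦⊗⟧ {N} x y = ≋-trans (⟦mod⟧ (toℕ x ℕ.* toℕ y) N) (≡⇒≋ (ℤ.pos-* (toℕ x) (toℕ y)))

-- Quadratic polynomials modulo n and 2n.

quadratic : ℤ → ℤ → ℤ → ℤ
quadratic a b t = a * (t * t) + b * t

quadratic-cong : ∀ a b → i ≋ j [ m ] → quadratic a b i ≋ quadratic a b j [ m ]
quadratic-cong a b p =
  +-cong-≋ (*-cong-≋ (≋-refl {a}) (*-cong-≋ p p)) (*-cong-≋ (≋-refl {b}) p)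

⟦π⟧ : ∀ {N} .{{_ : NonZero N}} (a b k : Fin N) →
      ⟦ π a b k ⟧ ≋ quadratic ⟦ a ⟧ ⟦ b ⟧ ⟦ k ⟧ [ + N ]
⟦π⟧ a b k = ≋-trans (⟦⊕⟧ (a ⊗ (k ⊗ k)) (b ⊗ k))
  (+-cong-≋ (≋-trans (⟦⊗⟧ a (k ⊗ k)) (*-cong-≋ (≋-refl {⟦ a ⟧}) (⟦⊗⟧ k k))) (⟦⊗⟧ b k))

-- Modulo 2n, replacing j by j + m n adds a m² n² + b m n, an even multiple of n because b and
-- a n have the same parity.
quadratic-periodic : ∀ a b → b ≋ a * n [ + 2 ] → i ≋ j [ n ] →
                     quadratic a b i ≋ quadratic a b j [ + 2 * n ]
quadratic-periodic {n} {i} {j} a b (from-∣ (divides c b-an≡2c)) (from-∣ (divides m i-j≡mn)) =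
  from-∣ (subst (+ 2 * n ∣_)
    (trans (lemma a c j m n)
           (cong₂ (λ b i → quadratic a b i - quadratic a b j)
                  (solve-for b (a * n) b-an≡2c) (solve-for i j i-j≡mn)))
    (∣m∣n⇒∣m+n (divides (a * m * j + c * m) refl)
               (∣n⇒∣m*n (a * n) (*-monoˡ-∣ n (2∣i²+i m)))))
  where
  lemma : ∀ a c j m n →
    (a * m * j + c * m) * (+ 2 * n) + a * n * ((m * m + m) * n) ≡
    a * ((m * n + j) * (m * n + j)) + (c * + 2 + a * n) * (m * n + j) -
    (a * (j * j) + (c * + 2 + a * n) * j)
  lemma = solve-∀
  solve-for : ∀ x y {z} → x - y ≡ z → z + y ≡ x
  solve-for x y refl = cancel x y
    where
    cancel : ∀ x y → x - y + y ≡ x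
    cancel = solve-∀

-- The coefficients on the right arise by replacing k⁴ with k² and k³ with k. The error is u a² (k⁴
-- - k²) + 2 u a b (k³ - k), a multiple of 12a and hence of 2n.
quadratic-∘-quadratic : ∀ u c a b k → n ∣ + 6 * a →
  quadratic u (u * c) (quadratic a b (+ k)) ≋
  quadratic (u * (a * a + b * b + c * a)) (u * (+ 2 * (a * b) + c * b)) (+ k) [ + 2 * n ]
quadratic-∘-quadratic {n} u c a b k n∣6a = from-∣ (subst (_ ∣_) (lemma u c a b (+ k))
  (∣-trans 2n∣12a (∣m∣n⇒∣m+n
    (∣n⇒∣m*n (u * a) (*-monoʳ-∣ a (12∣n⁴-n² k)))
    (∣n⇒∣m*n (u * b) (subst (_∣ + 2 * a * k³-k) (2*a*6 a) (*-monoʳ-∣ (+ 2 * a) (6∣n³-n k)))))))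
  where
  k³-k = + k * + k * + k - + k
  2*a*6 : ∀ a → + 2 * a * + 6 ≡ a * + 12
  2*a*6 = solve-∀
  2*6*a : ∀ a → + 2 * (+ 6 * a) ≡ a * + 12
  2*6*a = solve-∀
  2n∣12a : + 2 * n ∣ a * + 12
  2n∣12a = subst (+ 2 * n ∣_) (2*6*a a) (*-monoʳ-∣ (+ 2) n∣6a)
  lemma : ∀ u c a b k →
    u * a * (a * (k * k * (k * k) - k * k)) + u * b * (+ 2 * a * (k * k * k - k)) ≡
    u * ((a * (k * k) + b * k) * (a * (k * k) + b * k)) + u * c * (a * (k * k) + b * k) -
    (u * (a * a + b * b + c * a) * (k * k) + u * (+ 2 * (a * b) + c * b) * k)
  lemma = solve-∀

-- The weights are those of 2 Δ³(0) - Δ³(1), whose terms at k = 0 vanish; Δ³ kills quadratics.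
∣12ua[a+b] : ∀ u c a b A B →
  (∀ k → quadratic u (u * c) (quadratic a b (+ k)) ≋ quadratic A B (+ k) [ m ]) →
  m ∣ + 12 * (u * ((a + b) * a))
∣12ua[a+b] u c a b A B agree = subst (_ ∣_) (lemma u c a b A B)
  (∣m∣n⇒∣m-n (∣m∣n⇒∣m+n (D 3 (+ 5)) (D 1 (+ 7))) (∣m∣n⇒∣m+n (D 4 1ℤ) (D 2 (+ 9))))
  where
  D : ∀ k w → _ ∣ w * (quadratic u (u * c) (quadratic a b (+ k)) - quadratic A B (+ k))
  D k w = ∣n⇒∣m*n w (to-∣ (agree k))
  lemma : ∀ u c a b A B →
    + 5 * (u * ((a * + 9 + b * + 3) * (a * + 9 + b * + 3)) + u * c * (a * + 9 + b * + 3) -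
           (A * + 9 + B * + 3)) +
    + 7 * (u * ((a * + 1 + b * + 1) * (a * + 1 + b * + 1)) + u * c * (a * + 1 + b * + 1) -
           (A * + 1 + B * + 1)) -
    (+ 1 * (u * ((a * + 16 + b * + 4) * (a * + 16 + b * + 4)) + u * c * (a * + 16 + b * + 4) -
           (A * + 16 + B * + 4)) +
     + 9 * (u * ((a * + 4 + b * + 2) * (a * + 4 + b * + 2)) + u * c * (a * + 4 + b * + 2) -
           (A * + 4 + B * + 2))) ≡
    + 12 * (u * ((a + b) * a))
  lemma = solve-∀

-- Injectivity and surjectivity on finite sets.

injective⇒strictlySurjective : ∀ {n} {f : Fin n → Fin n} →
  Injective _≡_ _≡_ f → StrictlySurjective _≡_ f
injective⇒strictlySurjective {suc n} {f} f-inj x with any? (λ j → f j ≟ᶠ x)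
... | yes ∃j = ∃j
-- Pigeonhole: punching out a missed value `x` would inject `Fin (suc n)` into `Fin n`.
... | no ∄j = contradiction (injective⇒≤ missing-x-injective) ℕ.1+n≰n
  where
  x≢f : ∀ j → x ≢ f j
  x≢f j x≡fj = ∄j (j , sym x≡fj)
  missing-x-injective : Injective _≡_ _≡_ (λ j → punchOut (x≢f j))
  missing-x-injective {j} {k} eq = f-inj (punchOut-injective (x≢f j) (x≢f k) eq)

-- A section g of f is injective, hence surjective, hence also a left inverse of f.
strictlySurjective⇒injective : ∀ {n} {f : Fin n → Fin n} →
  StrictlySurjective _≡_ f → Injective _≡_ _≡_ f
strictlySurjective⇒injective {f = f} surj {x} {y} fx≡fy = begin
  x        ≡⟨ g∘f x ⟨
  g (f x)  ≡⟨ cong g fx≡fy ⟩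
  g (f y)  ≡⟨ g∘f y ⟩
  y        ∎
  where
  open ≡-Reasoning
  g = λ i → proj₁ (surj i)
  f∘g : ∀ i → f (g i) ≡ i
  f∘g i = proj₂ (surj i)
  g∘f : ∀ i → g (f i) ≡ i
  g∘f i with j , refl ← injective⇒strictlySurjective
    (λ {i} {j} eq → trans (sym (f∘g i)) (trans (cong f eq) (f∘g j))) i
    = cong g (f∘g j)

-- Primes, exact prime powers and coprimality.

prime-divisor : ∀ n .{{_ : NonZero n}} → n ≡ 1 ⊎ ∃[ p ] Prime p × p ℕ.∣ n
prime-divisor n with factorise n
... | record { factors = [] ; isFactorisation = n≡1 } = inj₁ n≡1
... | record { factors = p ∷ ps ; isFactorisation = n≡p*ps ; factorsPrime = p-prime ∷ _ } =
  inj₂ (p , p-prime , subst (p ℕ.∣_) (sym n≡p*ps) (ℕ.m∣m*n (product ps)))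

no-common-prime⇒coprime : ∀ m n .{{_ : NonZero n}} →
  (∀ p → Prime p → p ℕ.∣ m → ¬ p ℕ.∣ n) → ℕ.Coprime m n
no-common-prime⇒coprime m n none {zero} (_ , 0∣n) = contradiction (ℕ.0∣⇒≡0 0∣n) (ℕ.≢-nonZero⁻¹ n)
no-common-prime⇒coprime m n none {d@(suc _)} (d∣m , d∣n) with prime-divisor d
... | inj₁ d≡1 = d≡1
... | inj₂ (p , p-prime , p∣d) =
  contradiction (ℕ.∣-trans p∣d d∣n) (none p p-prime (ℕ.∣-trans p∣d d∣m))

prime∣prime⇒≡ : ∀ {p r} → Prime p → Prime r → p ℕ.∣ r → p ≡ r
prime∣prime⇒≡ p-prime r-prime p∣r with prime⇒irreducible r-prime p∣r
... | inj₁ refl = contradiction p-prime ¬prime[1]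
... | inj₂ p≡r  = p≡r

prime∣^⇒∣ : ∀ {p} → Prime p → ∀ m k → p ℕ.∣ m ℕ.^ k → p ℕ.∣ m
prime∣^⇒∣ p-prime m zero    p∣1 with refl ← ℕ.∣1⇒≡1 p∣1 = contradiction p-prime ¬prime[1]
prime∣^⇒∣ p-prime m (suc k) p∣m^1+k with euclidsLemma m (m ℕ.^ k) p-prime p∣m^1+k
... | inj₁ p∣m   = p∣m
... | inj₂ p∣m^k = prime∣^⇒∣ p-prime m k p∣m^k

prime^-coprime : ∀ {p m} → Prime p → .{{_ : NonZero m}} → p ℕ.∤ m →
                 ∀ k → ℕ.Coprime (p ℕ.^ k) m
prime^-coprime {p} {m} p-prime p∤m k =
  no-common-prime⇒coprime (p ℕ.^ k) m λ r r-prime r∣p^k r∣m →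
  p∤m (subst (ℕ._∣ m) (prime∣prime⇒≡ r-prime p-prime (prime∣^⇒∣ r-prime p k r∣p^k)) r∣m)

n<p^n : ∀ p .{{_ : ℕ.NonTrivial p}} n → n ℕ.< p ℕ.^ n
n<p^n p zero = s≤s z≤n
n<p^n p (suc n) =
  ℕ.≤-<-trans (n<p^n p n) (ℕ.^-monoʳ-< p (ℕ.nonTrivial⇒n>1 p) (ℕ.n<1+n n))

-- The search descends from the exponent n, where n < p^n rules out divisibility. It carries the
-- refuted exponent k + 1 along until p^k divides n.
exact-power : ∀ p .{{_ : ℕ.NonTrivial p}} n .{{_ : NonZero n}} → ∃[ α ] p ^ α ∥ n
exact-power p n = search n (ℕ.>⇒∤ (n<p^n p n))
  where
  search : ∀ k → p ℕ.^ k ℕ.∤ n → ∃[ α ] p ^ α ∥ n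
  search zero    1∤n = contradiction (ℕ.1∣ n) 1∤n
  search (suc k) p^1+k∤n with p ℕ.^ k ℕ.∣? n
  ... | yes p^k∣n = k , p^k∣n , p^1+k∤n
  ... | no  p^k∤n = search k p^k∤n

-- Write n = h g with g = gcd(n, m). A prime p dividing h would make p · p^α divide h g = n, because
-- p^α divides both n and m. Hence h = 1 and n = g.
prime-powers∣⇒∣ : ∀ n .{{_ : NonZero n}} m →
  (∀ p α → Prime p → p ℕ.∣ n → p ^ α ∥ n → p ℕ.^ α ℕ.∣ m) → n ℕ.∣ m
prime-powers∣⇒∣ n m local with ℕ.gcd[m,n]∣m n m
... | n/g@(ℕ.divides h n≡hg) with prime-divisor h {{ℕ.quotient≢0 n/g}}
... | inj₁ refl = subst (ℕ._∣ m) (sym (trans n≡hg (ℕ.*-identityˡ _))) (ℕ.gcd[m,n]∣n n m)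
... | inj₂ (p , p-prime , p∣h)
  with α , p^α∥n@(p^α∣n , p^1+α∤n) ← exact-power p {{prime⇒nonTrivial p-prime}} n =
  contradiction
    (subst (p ℕ.^ suc α ℕ.∣_) (sym n≡hg) (ℕ.*-pres-∣ p∣h (ℕ.gcd-greatest p^α∣n p^α∣m)))
    p^1+α∤n
  where
  p^α∣m = local p α p-prime (ℕ.∣-trans p∣h (ℕ.quotient-∣ n/g)) p^α∥n

-- The exponents η(p, α) and the condition N ∣ 6a.

η≤ : ∀ p α → η p α ≤ α
η≤ 0 α = ℕ.≤-refl
η≤ 1 α = ℕ.≤-refl
η≤ 2 0 = ℕ.≤-refl
η≤ 2 1 = z≤n
η≤ 2 (suc (suc α)) = ℕ.n≤1+n (suc α)
η≤ 3 α = ℕ.m∸n≤m α 1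
η≤ (suc (suc (suc (suc p)))) α = ℕ.≤-refl

-- η falls short of α by at most one, and only at p = 2 and p = 3, where 6 supplies the missing
-- prime.
^η∣⇒^∣6* : ∀ p α a → p ℕ.^ η p α ℕ.∣ a → p ℕ.^ α ℕ.∣ 6 ℕ.* a
^η∣⇒^∣6* 0 α a = ℕ.∣n⇒∣m*n 6
^η∣⇒^∣6* 1 α a = ℕ.∣n⇒∣m*n 6
^η∣⇒^∣6* 2 0 a _ = ℕ.1∣ (6 ℕ.* a)
^η∣⇒^∣6* 2 1 a _ = ℕ.∣m⇒∣m*n a (ℕ.m∣m*n 3)
^η∣⇒^∣6* 2 (suc (suc α)) a = ℕ.*-pres-∣ (ℕ.m∣m*n {2} 3)
^η∣⇒^∣6* 3 0 a _ = ℕ.1∣ (6 ℕ.* a)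
^η∣⇒^∣6* 3 (suc α) a = ℕ.*-pres-∣ (ℕ.m∣m*n {3} 2)
^η∣⇒^∣6* (suc (suc (suc (suc p)))) α a = ℕ.∣n⇒∣m*n 6

prime[3] : Prime 3
prime[3] = from-yes (prime? 3)

-- A prime p > 3 is prime to 6. For p = 2 or 3 one factor p cancels against 6, and the cofactor 3 or
-- 2 is prime to the power of p that remains.
^∣6*⇒^η∣ : ∀ p α a → Prime p → p ℕ.^ α ℕ.∣ 6 ℕ.* a → p ℕ.^ η p α ℕ.∣ a
^∣6*⇒^η∣ 0 α a p-prime = contradiction p-prime ¬prime[0]
^∣6*⇒^η∣ 1 α a p-prime = contradiction p-prime ¬prime[1]
^∣6*⇒^η∣ 2 0 a _ _ = ℕ.1∣ a
^∣6*⇒^η∣ 2 1 a _ _ = ℕ.1∣ a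
^∣6*⇒^η∣ 2 (suc (suc α)) a _ p = ℕ.coprime-divisor
  (prime^-coprime prime[2] (from-no (2 ℕ.∣? 3)) (suc α))
  (ℕ.*-cancelˡ-∣ 2 (subst (2 ℕ.^ suc (suc α) ℕ.∣_) (ℕ.*-assoc 2 3 a) p))
^∣6*⇒^η∣ 3 0 a _ _ = ℕ.1∣ a
^∣6*⇒^η∣ 3 (suc α) a _ p = ℕ.coprime-divisor
  (prime^-coprime prime[3] (from-no (3 ℕ.∣? 2)) α)
  (ℕ.*-cancelˡ-∣ 3 (subst (3 ℕ.^ suc α ℕ.∣_) (ℕ.*-assoc 3 2 a) p))
^∣6*⇒^η∣ p@(suc (suc (suc (suc _)))) α a p-prime =
  ℕ.coprime-divisor (prime^-coprime p-prime p∤6 α)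
  where
  p∤6 : p ℕ.∤ 6
  p∤6 p∣6 with euclidsLemma 2 3 p-prime p∣6
  ... | inj₁ p∣2 = contradiction p∣2 (ℕ.>⇒∤ (s≤s (s≤s (s≤s z≤n))))
  ... | inj₂ p∣3 = contradiction p∣3 (ℕ.>⇒∤ (s≤s (s≤s (s≤s (s≤s z≤n)))))

module _ {N p} (p-prime : Prime p) (α : ℕ) (a : Fin N) (t : ℕ) where
  private instance
    _ = prime⇒nonZero p-prime
    _ = ℕ.m^n≢0 p α

  private
    mod≋ : ∀ k → ⟦ k mod (p ℕ.^ α) ⟧ ≋ + k [ + (p ℕ.^ α) ]
    mod≋ k = ⟦mod⟧ k (p ℕ.^ α)

  -- Since p^t divides p^α, the congruence modulo p^α descends to p^t, where p^t c vanishes.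
  Valuation≥⇒∣ : t ≤ α → Valuation≥ p-prime α a t → p ℕ.^ t ℕ.∣ toℕ a
  Valuation≥⇒∣ t≤α (c , a≡p^tc) =
    ∣⇒∣ᵤ (∣-resp-≋ (≋-sym (≋-weaken p^t∣p^α a≋p^tc)) (∣m⇒∣m*n ⟦ c ⟧ ∣-refl))
    where
    p^t∣p^α : + (p ℕ.^ t) ∣ + (p ℕ.^ α)
    p^t∣p^α = ∣ᵤ⇒∣ (ℕ.divides (p ℕ.^ (α ℕ.∸ t))
      (trans (cong (p ℕ.^_) (sym (ℕ.m∸n+n≡m t≤α))) (ℕ.^-distribˡ-+-* p (α ℕ.∸ t) t)))
    a≋p^tc : ⟦ a ⟧ ≋ + (p ℕ.^ t) * ⟦ c ⟧ [ + (p ℕ.^ α) ]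
    a≋p^tc = ≋-trans (≋-sym (mod≋ (toℕ a))) (≋-trans (≡⇒≋ (cong ⟦_⟧ a≡p^tc))
      (≋-trans (⟦⊗⟧ ((p ℕ.^ t) mod (p ℕ.^ α)) c) (*-cong-≋ (mod≋ (p ℕ.^ t)) ≋-refl)))

  ∣⇒Valuation≥ : p ℕ.^ t ℕ.∣ toℕ a → Valuation≥ p-prime α a t
  ∣⇒Valuation≥ (ℕ.divides c a≡cp^t) = c mod (p ℕ.^ α) , ⟦⟧-injective-≋ _ _
    (≋-trans (mod≋ (toℕ a)) (≋-trans
      (≡⇒≋ (trans (cong +_ (trans a≡cp^t (ℕ.*-comm c (p ℕ.^ t)))) (ℤ.pos-* (p ℕ.^ t) c)))
      (≋-sym (≋-trans (⟦⊗⟧ ((p ℕ.^ t) mod (p ℕ.^ α)) (c mod (p ℕ.^ α)))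
        (*-cong-≋ (mod≋ (p ℕ.^ t)) (mod≋ c))))))

module _ {N : ℕ} .{{_ : NonZero N}} (a : Fin N) where

  ∣6a⇒valuations : N ℕ.∣ 6 ℕ.* toℕ a → ∀ p α (p-prime : Prime p) → p ℕ.∣ N → p ^ α ∥ N →
                   Valuation≥ p-prime α a (η p α)
  ∣6a⇒valuations N∣6a p α p-prime _ (p^α∣N , _) =
    ∣⇒Valuation≥ p-prime α a (η p α) (^∣6*⇒^η∣ p α (toℕ a) p-prime (ℕ.∣-trans p^α∣N N∣6a))

  valuations⇒∣6a : (∀ p α (p-prime : Prime p) → p ℕ.∣ N → p ^ α ∥ N →
                   Valuation≥ p-prime α a (η p α)) → N ℕ.∣ 6 ℕ.* toℕ a
  valuations⇒∣6a v = prime-powers∣⇒∣ N (6 ℕ.* toℕ a) λ p α p-prime p∣N p^α∥N →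
    ^η∣⇒^∣6* p α (toℕ a)
      (Valuation≥⇒∣ p-prime α a (η p α) (η≤ p α) (v p α p-prime p∣N p^α∥N))

-- Arithmetic of quadratic permutation polynomials modulo divisors of N.

euclid : ∀ {p} → Prime p → ∀ i j → + p ∣ i * j → + p ∣ i ⊎ + p ∣ j
euclid {p} p-prime i j p∣ij = Sum.map ∣ᵤ⇒∣ ∣ᵤ⇒∣
  (euclidsLemma ℤ.∣ i ∣ ℤ.∣ j ∣ p-prime (subst (p ℕ.∣_) (ℤ.abs-* i j) (∣⇒∣ᵤ p∣ij)))

prime∣i²⇒∣i : ∀ {p} → Prime p → ∀ i → + p ∣ i * i → + p ∣ i
prime∣i²⇒∣i p-prime i p∣i² with euclid p-prime i i p∣i²
... | inj₁ p∣i = p∣i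
... | inj₂ p∣i = p∣i

module QPP {N : ℕ} .{{_ : NonZero N}} (a b : Fin N) (qpp : IsQPP a b) where
  private
    A = ⟦ a ⟧
    B = ⟦ b ⟧

  -- Surjectivity passes to the quotient ℤ/d of ℤ/N, hence so does injectivity.
  quadratic-injective : ∀ {d} .{{_ : NonZero d}} → d ℕ.∣ N → ∀ m n →
    quadratic A B (+ m) ≋ quadratic A B (+ n) [ + d ] → + m ≋ + n [ + d ]
  quadratic-injective {d} d∣N m n p = ≋-trans (≋-sym (⟦mod⟧ m d))
    (≋-trans (≡⇒≋ (cong ⟦_⟧ (strictlySurjective⇒injective f-surjective fm≡fn))) (⟦mod⟧ n d))
    where
    f : Fin d → Fin d
    f k = toℕ (π a b (toℕ k mod N)) mod d
    ⟦f⟧ : ∀ k → ⟦ f k ⟧ ≋ quadratic A B ⟦ k ⟧ [ + d ]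
    ⟦f⟧ k = ≋-trans (⟦mod⟧ (toℕ (π a b (toℕ k mod N))) d)
      (≋-weaken (∣ᵤ⇒∣ d∣N) (≋-trans (⟦π⟧ a b (toℕ k mod N))
        (quadratic-cong A B (⟦mod⟧ (toℕ k) N))))
    f-mod : ∀ m → ⟦ f (m mod d) ⟧ ≋ quadratic A B (+ m) [ + d ]
    f-mod m = ≋-trans (⟦f⟧ (m mod d)) (quadratic-cong A B (⟦mod⟧ m d))
    fm≡fn : f (m mod d) ≡ f (n mod d)
    fm≡fn = ⟦⟧-injective-≋ _ _ (≋-trans (f-mod m) (≋-trans p (≋-sym (f-mod n))))
    f-surjective : StrictlySurjective _≡_ f
    f-surjective j with k , πk≡j ← proj₂ qpp (toℕ j mod N) =
      toℕ k mod d , ⟦⟧-injective-≋ _ _ (≋-trans (f-mod (toℕ k)) (≋-weaken (∣ᵤ⇒∣ d∣N)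
        (≋-trans (≋-sym (⟦π⟧ a b k)) (≋-trans (≡⇒≋ (cong ⟦_⟧ (πk≡j refl))) (⟦mod⟧ (toℕ j) N)))))

  -- The values at 1 and 0 differ by a + b, so modulo a common divisor of a + b and N they coincide.
  -- Injectivity there gives 1 ≡ 0.
  a+b-coprime : ℕ.Coprime (toℕ a ℕ.+ toℕ b) N
  a+b-coprime {zero} (_ , 0∣N) = contradiction (ℕ.0∣⇒≡0 0∣N) (ℕ.≢-nonZero⁻¹ N)
  a+b-coprime {suc d} (d∣a+b , d∣N) = ℕ.∣1⇒≡1 (∣⇒∣ᵤ (to-∣ (quadratic-injective d∣N 1 0
    (from-∣ (subst (+ suc d ∣_) (lemma A B) (∣ᵤ⇒∣ d∣a+b))))))
    where
    lemma : ∀ a b → a + b ≡ a * + 1 + b * + 1 - (a * + 0 + b * + 0)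
    lemma = solve-∀

  prime∤a+b : ∀ {p} → Prime p → p ℕ.∣ N → ¬ + p ∣ A + B
  prime∤a+b p-prime p∣N p∣a+b with refl ← a+b-coprime (∣⇒∣ᵤ p∣a+b , p∣N) = ¬prime[1] p-prime

  -- 3 divides a b (a + b) (2a + b) for all a and b, but here none of the last three factors.
  3∣N⇒3∣a : 3 ℕ.∣ N → + 3 ∣ A
  3∣N⇒3∣a 3∣N = 3∣a (euclid prime[3] A _ (subst (+ 3 ∣_) (lemma A B)
    (∣m∣n⇒∣m+n (∣m∣n⇒∣m+n (∣n⇒∣m*n A (3∣n³-n (toℕ b))) (∣n⇒∣m*n (+ 2 * B) (3∣n³-n (toℕ a))))
               (∣m⇒∣m*n (A * B + A * A * B * B) ∣-refl))))
    where
    3∣n³-n : ∀ n → + 3 ∣ + n * + n * + n - + n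
    3∣n³-n n = ∣-trans (divides (+ 2) refl) (6∣n³-n n)
    lemma : ∀ a b →
      a * (b * b * b - b) + + 2 * b * (a * a * a - a) + + 3 * (a * b + a * a * b * b) ≡
      a * (b * ((a + b) * (+ 2 * a + b)))
    lemma = solve-∀
    b-lemma : ∀ a b → + 3 * a + b ≡ a * + 4 + b * + 2 - (a * + 1 + b * + 1)
    b-lemma = solve-∀
    2a+b-lemma : ∀ a b → + 2 * (+ 2 * a + b) ≡ a * + 4 + b * + 2 - (a * + 0 + b * + 0)
    2a+b-lemma = solve-∀
    -- Otherwise the values at 2 and 1, which differ by 3a + b, would agree modulo 3.
    3∤b : ¬ + 3 ∣ B
    3∤b 3∣b = from-no (3 ℕ.∣? 1) (∣⇒∣ᵤ (to-∣ (quadratic-injective 3∣N 2 1 (from-∣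
      (subst (+ 3 ∣_) (b-lemma A B) (∣m∣n⇒∣m+n (∣m⇒∣m*n A ∣-refl) 3∣b))))))
    -- Otherwise the values at 2 and 0, which differ by 2 (2a + b), would agree modulo 3.
    3∤2a+b : ¬ + 3 ∣ + 2 * A + B
    3∤2a+b 3∣2a+b = from-no (3 ℕ.∣? 2) (∣⇒∣ᵤ (to-∣ (quadratic-injective 3∣N 2 0 (from-∣
      (subst (+ 3 ∣_) (2a+b-lemma A B) (∣n⇒∣m*n (+ 2) 3∣2a+b))))))
    3∣a : + 3 ∣ A ⊎ + 3 ∣ B * ((A + B) * (+ 2 * A + B)) → + 3 ∣ A
    3∣a (inj₁ r) = r
    3∣a (inj₂ r) with euclid prime[3] B _ r
    ... | inj₁ 3∣b = contradiction 3∣b 3∤b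
    ... | inj₂ s with euclid prime[3] (A + B) _ s
    ... | inj₁ 3∣a+b = contradiction 3∣a+b (prime∤a+b prime[3] 3∣N)
    ... | inj₂ 3∣2a+b = contradiction 3∣2a+b 3∤2a+b

  -- When p divides a, the coefficient is congruent to b² modulo p. Were it zero, p would divide b
  -- and therefore a + b.
  prime∤leading-of-∣a : ∀ c {p} → Prime p → p ℕ.∣ N → + p ∣ A → ¬ + p ∣ A * A + B * B + c * A
  prime∤leading-of-∣a c p-prime p∣N p∣a p∣lead = prime∤a+b p-prime p∣N
    (∣m∣n⇒∣m+n p∣a (prime∣i²⇒∣i p-prime B
      (subst (_ ∣_) (lemma A B c) (∣m∣n⇒∣m-n p∣lead (∣m⇒∣m*n (A + c) p∣a)))))
    where
    lemma : ∀ a b c → a * a + b * b + c * a - a * (a + c) ≡ b * b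
    lemma = solve-∀

  -- For even N the multiplier of a is 2q, so the coefficient is congruent to (a + b)² modulo 2.
  even⇒2∤leading : 2 ℕ.∣ N → ∀ q → ¬ + 2 ∣ A * A + B * B + (+ (N ℕ.% 2) + + 2 * q) * A
  even⇒2∤leading 2∣N q 2∣lead rewrite ℕ.n∣m⇒m%n≡0 N 2 2∣N =
    prime∤a+b prime[2] 2∣N (prime∣i²⇒∣i prime[2] (A + B) (subst (+ 2 ∣_) (lemma A B q)
      (∣m∣n⇒∣m+n 2∣lead (∣m⇒∣m*n (A * B - q * A) ∣-refl))))
    where
    lemma : ∀ a b q →
      a * a + b * b + (+ 0 + + 2 * q) * a + + 2 * (a * b - q * a) ≡ (a + b) * (a + b)
    lemma = solve-∀

  -- From p ∣ N ∣ 6a, either p divides a, or p = 2, or p = 3; the last case falls back on the first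
  -- because 3 ∣ N forces 3 ∣ a.
  prime∤leading : N ℕ.∣ 6 ℕ.* toℕ a → ∀ q {p} → Prime p → p ℕ.∣ N →
    ¬ + p ∣ A * A + B * B + (+ (N ℕ.% 2) + + 2 * q) * A
  prime∤leading N∣6a q p-prime p∣N
    with euclidsLemma 6 (toℕ a) p-prime (ℕ.∣-trans p∣N N∣6a)
  ... | inj₂ p∣a = prime∤leading-of-∣a (+ (N ℕ.% 2) + + 2 * q) p-prime p∣N (∣ᵤ⇒∣ p∣a)
  ... | inj₁ p∣6 with euclidsLemma 2 3 p-prime p∣6
  ... | inj₁ p∣2 with refl ← prime∣prime⇒≡ p-prime prime[2] p∣2 = even⇒2∤leading p∣N q
  ... | inj₂ p∣3 with refl ← prime∣prime⇒≡ p-prime prime[3] p∣3 =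
    prime∤leading-of-∣a (+ (N ℕ.% 2) + + 2 * q) prime[3] p∣N (3∣N⇒3∣a p∣N)

-- Integer powers of unimodular elements and of primitive roots.

module _ {c ℓ} (R : InvolutiveRing c ℓ) where
  open InvolutiveRing R
  open CommutativeRing commutativeRing
    using (setoid; *-cong; *-congˡ; *-congʳ; *-identityˡ; *-identityʳ; *-comm;
           *-commutativeMonoid)
    renaming (refl to ≈-refl; sym to ≈-sym; trans to ≈-trans)
  open RingMorphisms.IsRingHomomorphism conj-isRingHomomorphism
    using () renaming (⟦⟧-cong to conj-cong; *-homo to conj-*; 1#-homo to conj-1#)
  open Exp semiring using (^-congˡ; ^-homo-*; ^-assocʳ)
  open CommutativeSemigroupProperties (CommutativeMonoid.commutativeSemigroup *-commutativeMonoid)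
    using (interchange; x∙yz≈y∙xz)
  open SetoidReasoning setoid

  conj-^ⁿ : ∀ x n → conj (x ^ⁿ n) ≈ conj x ^ⁿ n
  conj-^ⁿ x zero    = conj-1#
  conj-^ⁿ x (suc n) = ≈-trans (conj-* x (x ^ⁿ n)) (*-congˡ (conj-^ⁿ x n))

  1^ⁿ : ∀ n → 1# ^ⁿ n ≈ 1#
  1^ⁿ zero    = ≈-refl
  1^ⁿ (suc n) = ≈-trans (*-identityˡ _) (1^ⁿ n)

  conj-^ᶻ : ∀ x i → conj (x ^ᶻ i) ≈ x ^ᶻ (- i)
  conj-^ᶻ x (+ zero)  = conj-1#
  conj-^ᶻ x (+ suc n) = conj-^ⁿ x (suc n)
  conj-^ᶻ x -[1+ n ]  = ≈-trans (conj-^ⁿ (conj x) (suc n)) (^-congˡ (suc n) (conj-involutive x))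

  x≈1⇒conj≈1 : ∀ {x} → x ≈ 1# → conj x ≈ 1#
  x≈1⇒conj≈1 x≈1 = ≈-trans (conj-cong x≈1) conj-1#

  module UnimodularPowers {ζ : Carrier} (ζζ̄≈1 : Unimodular ζ) where

    -- Handles exponents of mixed sign: each step of the recursion cancels one factor ζ · conj ζ =
    -- 1.
    ^ᶻ-⊖ : ∀ m n → ζ ^ᶻ (m ℤ.⊖ n) ≈ ζ ^ⁿ m · conj ζ ^ⁿ n
    ^ᶻ-⊖ zero    zero    = ≈-sym (*-identityˡ _)
    ^ᶻ-⊖ zero    (suc n) = ≈-sym (*-identityˡ _)
    ^ᶻ-⊖ (suc m) zero    = ≈-sym (*-identityʳ _)
    ^ᶻ-⊖ (suc m) (suc n) = begin
      ζ ^ᶻ (suc m ℤ.⊖ suc n)               ≡⟨ cong (ζ ^ᶻ_) (ℤ.[1+m]⊖[1+n]≡m⊖n m n) ⟩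
      ζ ^ᶻ (m ℤ.⊖ n)                       ≈⟨ ^ᶻ-⊖ m n ⟩
      ζ ^ⁿ m · conj ζ ^ⁿ n                 ≈⟨ *-identityˡ _ ⟨
      1# · (ζ ^ⁿ m · conj ζ ^ⁿ n)          ≈⟨ *-congʳ ζζ̄≈1 ⟨
      ζ · conj ζ · (ζ ^ⁿ m · conj ζ ^ⁿ n)  ≈⟨ interchange ζ (conj ζ) (ζ ^ⁿ m) (conj ζ ^ⁿ n) ⟩
      ζ ^ⁿ suc m · conj ζ ^ⁿ suc n         ∎

    ^ᶻ-+ : ∀ i j → ζ ^ᶻ (i + j) ≈ ζ ^ᶻ i · ζ ^ᶻ j
    ^ᶻ-+ (+ m)    (+ n)    = ^-homo-* ζ m n
    ^ᶻ-+ (+ m)    -[1+ n ] = ^ᶻ-⊖ m (suc n)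
    ^ᶻ-+ -[1+ m ] (+ n)    = ≈-trans (^ᶻ-⊖ n (suc m)) (*-comm _ _)
    ^ᶻ-+ -[1+ m ] -[1+ n ] = ≈-trans (*-congˡ (^-homo-* (conj ζ) (suc m) n)) (begin
      conj ζ · (conj ζ ^ⁿ suc m · conj ζ ^ⁿ n)  ≈⟨ x∙yz≈y∙xz _ _ _ ⟩
      conj ζ ^ⁿ suc m · conj ζ ^ⁿ suc n         ∎)

    ^ᶻ-unimodular : ∀ i → Unimodular (ζ ^ᶻ i)
    ^ᶻ-unimodular i = begin
      ζ ^ᶻ i · conj (ζ ^ᶻ i)  ≈⟨ *-congˡ (conj-^ᶻ ζ i) ⟩
      ζ ^ᶻ i · ζ ^ᶻ (- i)     ≈⟨ ^ᶻ-+ i (- i) ⟨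
      ζ ^ᶻ (i - i)            ≡⟨ cong (ζ ^ᶻ_) (ℤ.+-inverseʳ i) ⟩
      1#                      ∎

    ^ᶻ-+-≈1 : ∀ i j → ζ ^ᶻ j ≈ 1# → ζ ^ᶻ (i + j) ≈ ζ ^ᶻ i
    ^ᶻ-+-≈1 i j p = ≈-trans (^ᶻ-+ i j) (≈-trans (*-congˡ p) (*-identityʳ _))

  module PrimitiveRoot {M : ℕ} .{{_ : NonZero M}} {ζ : Carrier}
                       (ζζ̄≈1 : Unimodular ζ) (ζ-primitive : IsPrimitiveRoot M ζ) where
    open UnimodularPowers ζζ̄≈1

    ∣⇒^ⁿ≈1 : ∀ n → M ℕ.∣ n → ζ ^ⁿ n ≈ 1#
    ∣⇒^ⁿ≈1 .(q ℕ.* M) (ℕ.divides q refl) = begin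
      ζ ^ⁿ (q ℕ.* M)  ≡⟨ cong (ζ ^ⁿ_) (ℕ.*-comm q M) ⟩
      ζ ^ⁿ (M ℕ.* q)  ≈⟨ ^-assocʳ ζ M q ⟨
      (ζ ^ⁿ M) ^ⁿ q   ≈⟨ ^-congˡ q (proj₁ ζ-primitive) ⟩
      1# ^ⁿ q         ≈⟨ 1^ⁿ q ⟩
      1#              ∎

    -- The remainder r of n modulo M also satisfies ζ^r = 1, so minimality of the order M leaves
    -- only r = 0.
    ^ⁿ≈1⇒∣ : ∀ n → ζ ^ⁿ n ≈ 1# → M ℕ.∣ n
    ^ⁿ≈1⇒∣ n ζ^n≈1 with n ℕ.% M in n%M≡r
    ... | zero  = ℕ.m%n≡0⇒n∣m n M n%M≡r
    ... | suc r = contradiction ζ^r≈1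
      (proj₂ ζ-primitive (suc r) (s≤s z≤n) (subst (ℕ._< M) n%M≡r (ℕ.m%n<n n M)))
      where
      ζ^r≈1 : ζ ^ⁿ suc r ≈ 1#
      ζ^r≈1 = begin
        ζ ^ⁿ suc r  ≈⟨ *-identityʳ _ ⟨
        ζ ^ⁿ suc r · 1#
          ≈⟨ *-congˡ (∣⇒^ⁿ≈1 (n ℕ./ M ℕ.* M) (ℕ.n∣m*n (n ℕ./ M))) ⟨
        ζ ^ⁿ suc r · ζ ^ⁿ (n ℕ./ M ℕ.* M)  ≈⟨ ^-homo-* ζ (suc r) (n ℕ./ M ℕ.* M) ⟨
        ζ ^ⁿ (suc r ℕ.+ n ℕ./ M ℕ.* M)     ≡⟨ cong (λ r → ζ ^ⁿ (r ℕ.+ n ℕ./ M ℕ.* M)) n%M≡r ⟨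
        ζ ^ⁿ (n ℕ.% M ℕ.+ n ℕ./ M ℕ.* M)   ≡⟨ cong (ζ ^ⁿ_) (ℕ.m≡m%n+[m/n]*n n M) ⟨
        ζ ^ⁿ n                             ≈⟨ ζ^n≈1 ⟩
        1#                                 ∎

    ∣⇒^ᶻ≈1 : ∀ i → + M ∣ i → ζ ^ᶻ i ≈ 1#
    ∣⇒^ᶻ≈1 (+ n)    M∣i = ∣⇒^ⁿ≈1 n (∣⇒∣ᵤ M∣i)
    ∣⇒^ᶻ≈1 -[1+ n ] M∣i =
      ≈-trans (≈-sym (conj-^ᶻ ζ (+ suc n))) (x≈1⇒conj≈1 (∣⇒^ⁿ≈1 (suc n) (∣⇒∣ᵤ M∣i)))

    ^ᶻ≈1⇒∣ : ∀ i → ζ ^ᶻ i ≈ 1# → + M ∣ i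
    ^ᶻ≈1⇒∣ (+ n)    p = ∣ᵤ⇒∣ (^ⁿ≈1⇒∣ n p)
    ^ᶻ≈1⇒∣ -[1+ n ] p = ∣ᵤ⇒∣ (^ⁿ≈1⇒∣ (suc n) (≈-trans (≈-sym (conj-^ᶻ ζ -[1+ n ])) (x≈1⇒conj≈1 p)))

    ^ᶻ-cong-≋ : i ≋ j [ + M ] → ζ ^ᶻ i ≈ ζ ^ᶻ j
    ^ᶻ-cong-≋ {i} {j} (from-∣ M∣i-j) = begin
      ζ ^ᶻ i              ≡⟨ cong (ζ ^ᶻ_) (lemma i j) ⟨
      ζ ^ᶻ (j + (i - j))  ≈⟨ ^ᶻ-+-≈1 j (i - j) (∣⇒^ᶻ≈1 (i - j) M∣i-j) ⟩
      ζ ^ᶻ j              ∎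
      where
      lemma : ∀ i j → j + (i - j) ≡ i
      lemma = solve-∀

    ^ᶻ-injective-≋ : ∀ i j → ζ ^ᶻ i ≈ ζ ^ᶻ j → i ≋ j [ + M ]
    ^ᶻ-injective-≋ i j ζ^i≈ζ^j = from-∣ (^ᶻ≈1⇒∣ (i - j) (begin
      ζ ^ᶻ (i - j)            ≈⟨ ^ᶻ-+ i (- j) ⟩
      ζ ^ᶻ i · ζ ^ᶻ (- j)     ≈⟨ *-cong ζ^i≈ζ^j (≈-sym (conj-^ᶻ ζ j)) ⟩
      ζ ^ᶻ j · conj (ζ ^ᶻ j)  ≈⟨ ^ᶻ-unimodular j ⟩
      1#                      ∎))

-- Quadratic phases and their invariance under the five operations.

module QuadraticPhases {c ℓ} (R : InvolutiveRing c ℓ) (N : ℕ) .{{_ : NonZero N}}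
  (ζ : InvolutiveRing.Carrier R) (ζζ̄≈1 : InvolutiveRing.Unimodular R ζ)
  (ζ-primitive : InvolutiveRing.IsPrimitiveRoot R (2 ℕ.* N) ζ) where

  open InvolutiveRing R
  open CommutativeRing commutativeRing
    using (setoid; *-cong; *-congˡ; *-congʳ; *-identityˡ; *-identityʳ; *-assoc; *-comm;
           *-commutativeMonoid)
    renaming (sym to ≈-sym; trans to ≈-trans)
  open RingMorphisms.IsRingHomomorphism conj-isRingHomomorphism
    using () renaming (⟦⟧-cong to conj-cong; *-homo to conj-*)
  open Exp semiring using (^-assocʳ)
  open CommutativeSemigroupProperties (CommutativeMonoid.commutativeSemigroup *-commutativeMonoid)
    using (x∙yz≈y∙xz)
  open SetoidReasoning setoid
  open ZadoffChu R N ζ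
  private instance
    _ = ℕ.m*n≢0 2 N
  open UnimodularPowers R ζζ̄≈1
  open PrimitiveRoot R ζζ̄≈1 ζ-primitive

  ^ᶻ-cong-2N : i ≋ j [ + 2 * + N ] → ζ ^ᶻ i ≈ ζ ^ᶻ j
  ^ᶻ-cong-2N p = ^ᶻ-cong-≋ (subst (_ ≋ _ [_]) (sym (ℤ.pos-* 2 N)) p)

  ^ᶻ-injective-2N : ∀ i j → ζ ^ᶻ i ≈ ζ ^ᶻ j → i ≋ j [ + 2 * + N ]
  ^ᶻ-injective-2N i j p = subst (_ ≋ _ [_]) (ℤ.pos-* 2 N) (^ᶻ-injective-≋ i j p)

  ^ᶻ-quadratic-cong : ∀ a b → b ≋ a * + N [ + 2 ] → i ≋ j [ + N ] →
                      ζ ^ᶻ quadratic a b i ≈ ζ ^ᶻ quadratic a b j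
  ^ᶻ-quadratic-cong a b parity i≋j = ^ᶻ-cong-2N (quadratic-periodic a b parity i≋j)

  W^ⁿ : ∀ m n → W ^ⁿ (m ℕ.* n) ≈ ζ ^ᶻ (+ 2 * + m * + n)
  W^ⁿ m n = ≈-trans (^-assocʳ ζ 2 (m ℕ.* n)) (begin
    ζ ^ᶻ (+ (2 ℕ.* (m ℕ.* n)))  ≡⟨ cong (λ k → ζ ^ᶻ (+ k)) (ℕ.*-assoc 2 m n) ⟨
    ζ ^ᶻ (+ (2 ℕ.* m ℕ.* n))
      ≡⟨ cong (ζ ^ᶻ_) (trans (ℤ.pos-* (2 ℕ.* m) n) (cong (_* + n) (ℤ.pos-* 2 m))) ⟩
    ζ ^ᶻ (+ 2 * + m * + n)  ∎)

  -- The parity condition makes the phase a function on ℤ/N.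
  record IsQuadraticPhase (s : Sequence) : Set (c ⊔ ℓ) where
    constructor quadraticPhase
    field
      x      : Carrier
      a b    : ℤ
      parity : b ≋ a * + N [ + 2 ]
      phase  : ∀ k → s k ≈ x · ζ ^ᶻ quadratic a b ⟦ k ⟧

  private variable
    s s′ : Sequence

  scale-phase : ∀ w → (∀ k → s′ k ≈ w · s k) → IsQuadraticPhase s → IsQuadraticPhase s′
  scale-phase w eq (quadraticPhase x a b parity phase) =
    quadraticPhase (w · x) a b parity λ k →
      ≈-trans (eq k) (≈-trans (*-congˡ (phase k)) (≈-sym (*-assoc w x _)))

  -- Treats shifts (r = 1), decimations (e = 0) and their inverses together. Although `f` is affine
  -- only modulo N, the parity condition allows r k + e in its place in an exponent that matters
  -- modulo 2N.
  affine-phase : ∀ r e (f : Fin N → Fin N) → (∀ k → ⟦ f k ⟧ ≋ r * ⟦ k ⟧ + e [ + N ]) →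
                 (∀ k → s′ k ≈ s (f k)) → IsQuadraticPhase s → IsQuadraticPhase s′
  affine-phase {s′} {s} r e f f-affine eq (quadraticPhase x a b parity phase) =
    quadraticPhase (x · ζ ^ᶻ quadratic a b e) (a * (r * r)) b′ parity′ λ k → begin
      s′ k     ≈⟨ eq k ⟩
      s (f k)  ≈⟨ phase (f k) ⟩
      x · ζ ^ᶻ quadratic a b ⟦ f k ⟧
        ≈⟨ *-congˡ (^ᶻ-quadratic-cong a b parity (f-affine k)) ⟩
      x · ζ ^ᶻ quadratic a b (r * ⟦ k ⟧ + e)
        ≡⟨ cong (λ i → x · ζ ^ᶻ i) (expand a b r e ⟦ k ⟧) ⟩
      x · ζ ^ᶻ (quadratic a b e + quadratic (a * (r * r)) b′ ⟦ k ⟧)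
        ≈⟨ *-congˡ (^ᶻ-+ (quadratic a b e) (quadratic (a * (r * r)) b′ ⟦ k ⟧)) ⟩
      x · (ζ ^ᶻ quadratic a b e · ζ ^ᶻ quadratic (a * (r * r)) b′ ⟦ k ⟧)  ≈⟨ *-assoc _ _ _ ⟨
      x · ζ ^ᶻ quadratic a b e · ζ ^ᶻ quadratic (a * (r * r)) b′ ⟦ k ⟧    ∎
    where
    b′ = + 2 * (a * r * e) + b * r
    expand : ∀ a b r e k → a * ((r * k + e) * (r * k + e)) + b * (r * k + e) ≡
      a * (e * e) + b * e + (a * (r * r) * (k * k) + (+ 2 * (a * r * e) + b * r) * k)
    expand = solve-∀
    lemma : ∀ a b r e n →
      (b - a * n) * r + (+ 2 * (a * r * e + a * n * r) - a * n * (r * r + r)) ≡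
      + 2 * (a * r * e) + b * r - a * (r * r) * n
    lemma = solve-∀
    -- Modulo 2, b′ ≡ b r ≡ a N r, and r ≡ r² because r² + r is even.
    parity′ : b′ ≋ a * (r * r) * + N [ + 2 ]
    parity′ = from-∣ (subst (+ 2 ∣_) (lemma a b r e (+ N)) (∣m∣n⇒∣m+n (∣m⇒∣m*n r (to-∣ parity))
      (∣m∣n⇒∣m-n (∣m⇒∣m*n (a * r * e + a * + N * r) ∣-refl) (∣n⇒∣m*n (a * + N) (2∣i²+i r)))))

  modulate-phase : ∀ l → (∀ k → s′ k ≈ ζ ^ᶻ (+ 2 * l * ⟦ k ⟧) · s k) →
                   IsQuadraticPhase s → IsQuadraticPhase s′
  modulate-phase {s′} {s} l eq (quadraticPhase x a b parity phase) =
    quadraticPhase x a (+ 2 * l + b) parity′ λ k → begin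
      s′ k                                                     ≈⟨ eq k ⟩
      ζ ^ᶻ (+ 2 * l * ⟦ k ⟧) · s k                             ≈⟨ *-congˡ (phase k) ⟩
      ζ ^ᶻ (+ 2 * l * ⟦ k ⟧) · (x · ζ ^ᶻ quadratic a b ⟦ k ⟧)  ≈⟨ x∙yz≈y∙xz _ _ _ ⟩
      x · (ζ ^ᶻ (+ 2 * l * ⟦ k ⟧) · ζ ^ᶻ quadratic a b ⟦ k ⟧)
        ≈⟨ *-congˡ (^ᶻ-+ (+ 2 * l * ⟦ k ⟧) (quadratic a b ⟦ k ⟧)) ⟨
      x · ζ ^ᶻ (+ 2 * l * ⟦ k ⟧ + quadratic a b ⟦ k ⟧)
        ≡⟨ cong (λ i → x · ζ ^ᶻ i) (collect a b l ⟦ k ⟧) ⟩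
      x · ζ ^ᶻ quadratic a (+ 2 * l + b) ⟦ k ⟧  ∎
    where
    collect : ∀ a b l k → + 2 * l * k + (a * (k * k) + b * k) ≡ a * (k * k) + (+ 2 * l + b) * k
    collect = solve-∀
    lemma : ∀ b l an → + 2 * l + (b - an) ≡ + 2 * l + b - an
    lemma = solve-∀
    parity′ : + 2 * l + b ≋ a * + N [ + 2 ]
    parity′ = from-∣ (subst (+ 2 ∣_) (lemma b l (a * + N))
      (∣m∣n⇒∣m+n (∣m⇒∣m*n l ∣-refl) (to-∣ parity)))

  conjugate-phase : (∀ k → s′ k ≈ conj (s k)) → IsQuadraticPhase s → IsQuadraticPhase s′
  conjugate-phase {s′} {s} eq (quadraticPhase x a b parity phase) =
    quadraticPhase (conj x) (- a) (- b) parity′ λ k → begin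
      s′ k                                      ≈⟨ eq k ⟩
      conj (s k)                                ≈⟨ conj-cong (phase k) ⟩
      conj (x · ζ ^ᶻ quadratic a b ⟦ k ⟧)       ≈⟨ conj-* _ _ ⟩
      conj x · conj (ζ ^ᶻ quadratic a b ⟦ k ⟧)  ≈⟨ *-congˡ (conj-^ᶻ R ζ (quadratic a b ⟦ k ⟧)) ⟩
      conj x · ζ ^ᶻ (- quadratic a b ⟦ k ⟧)
        ≡⟨ cong (λ i → conj x · ζ ^ᶻ i) (negate a b ⟦ k ⟧) ⟩
      conj x · ζ ^ᶻ quadratic (- a) (- b) ⟦ k ⟧  ∎
    where
    negate : ∀ a b k → - (a * (k * k) + b * k) ≡ (- a) * (k * k) + (- b) * k
    negate = solve-∀
    lemma : ∀ a b n → - (b - a * n) ≡ - b - (- a) * n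
    lemma = solve-∀
    parity′ : - b ≋ (- a) * + N [ + 2 ]
    parity′ = from-∣ (subst (+ 2 ∣_) (lemma a b (+ N)) (∣m⇒∣-m (to-∣ parity)))

  operation-phase : Operation s s′ → IsQuadraticPhase s → IsQuadraticPhase s′
  operation-phase (scale w _ eq) = scale-phase w eq
  operation-phase (shift d eq) = affine-phase 1ℤ ⟦ d ⟧ (_⊕ d)
    (λ k → ≋-trans (⟦⊕⟧ k d) (≡⇒≋ (cong (_+ ⟦ d ⟧) (sym (ℤ.*-identityˡ ⟦ k ⟧))))) eq
  operation-phase (decimate r _ eq) = affine-phase ⟦ r ⟧ 0ℤ (r ⊗_)
    (λ k → ≋-trans (⟦⊗⟧ r k) (≡⇒≋ (sym (ℤ.+-identityʳ (⟦ r ⟧ * ⟦ k ⟧))))) eq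
  operation-phase (modulate l eq) = modulate-phase ⟦ l ⟧
    (λ k → ≈-trans (eq k) (*-congʳ (W^ⁿ (toℕ l) (toℕ k))))
  operation-phase (conjugate eq) = conjugate-phase eq

  cancel-unimodular : ∀ {w v v′} → Unimodular w → v′ ≈ w · v → v ≈ conj w · v′
  cancel-unimodular {w} {v} {v′} ww̄≈1 eq = begin
    v                 ≈⟨ *-identityˡ v ⟨
    1# · v            ≈⟨ *-congʳ ww̄≈1 ⟨
    w · conj w · v    ≈⟨ *-congʳ (*-comm w (conj w)) ⟩
    conj w · w · v    ≈⟨ *-assoc _ _ _ ⟩
    conj w · (w · v)  ≈⟨ *-congˡ eq ⟨
    conj w · v′       ∎

  substitute-inverse : ∀ (f g : Fin N → Fin N) → (∀ k → ⟦ f (g k) ⟧ ≋ ⟦ k ⟧ [ + N ]) →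
                       (∀ k → s′ k ≈ s (f k)) → ∀ k → s k ≈ s′ (g k)
  substitute-inverse {s′} {s} f g f∘g eq k = begin
    s k  ≡⟨ cong s (⟦⟧-injective-≋ _ _ (f∘g k)) ⟨
    s (f (g k)) ≈⟨ eq (g k) ⟨
    s′ (g k)  ∎

  -- `Equivalent` may traverse an operation backwards. Each is undone by one of the same type:
  -- scaling by conj w, shifting by -d, decimating by the inverse unit, modulating by -l,
  -- conjugating again.
  operation-phase⁻¹ : Operation s s′ → IsQuadraticPhase s′ → IsQuadraticPhase s
  operation-phase⁻¹ (scale w ww̄≈1 eq) =
    scale-phase (conj w) (λ k → cancel-unimodular ww̄≈1 (eq k))
  operation-phase⁻¹ {s} {s′} (shift d eq) =
    affine-phase 1ℤ (- ⟦ d ⟧) g (λ k → ⟦fromℤ⟧ N _)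
      (substitute-inverse {s′} {s} (_⊕ d) g inverse eq)
    where
    g : Fin N → Fin N
    -- The factor `1ℤ` gives the form r k + e that `affine-phase` expects.
    g k = fromℤ N (1ℤ * ⟦ k ⟧ - ⟦ d ⟧)
    lemma : ∀ k d → 1ℤ * k - d + d ≡ k
    lemma = solve-∀
    inverse : ∀ k → ⟦ g k ⊕ d ⟧ ≋ ⟦ k ⟧ [ + N ]
    inverse k = ≋-trans (⟦⊕⟧ (g k) d)
      (≋-trans (+-cong-≋ (⟦fromℤ⟧ N (1ℤ * ⟦ k ⟧ - ⟦ d ⟧)) (≋-refl {⟦ d ⟧}))
               (≡⇒≋ (lemma ⟦ k ⟧ ⟦ d ⟧)))
  operation-phase⁻¹ {s} {s′} (decimate r (r′ , rr′≡1) eq) =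
    affine-phase ⟦ r′ ⟧ 0ℤ (r′ ⊗_)
      (λ k → ≋-trans (⟦⊗⟧ r′ k) (≡⇒≋ (sym (ℤ.+-identityʳ (⟦ r′ ⟧ * ⟦ k ⟧)))))
      (substitute-inverse {s′} {s} (r ⊗_) (r′ ⊗_) inverse eq)
    where
    ⟦r⟧⟦r′⟧≋1 : ⟦ r ⟧ * ⟦ r′ ⟧ ≋ 1ℤ [ + N ]
    ⟦r⟧⟦r′⟧≋1 = ≋-trans (≋-sym (⟦⊗⟧ r r′)) (≋-trans (≡⇒≋ (cong ⟦_⟧ rr′≡1)) (⟦mod⟧ 1 N))
    inverse : ∀ k → ⟦ r ⊗ (r′ ⊗ k) ⟧ ≋ ⟦ k ⟧ [ + N ]
    inverse k = ≋-trans (⟦⊗⟧ r (r′ ⊗ k))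
      (≋-trans (*-cong-≋ (≋-refl {⟦ r ⟧}) (⟦⊗⟧ r′ k))
      (≋-trans (≡⇒≋ (sym (ℤ.*-assoc ⟦ r ⟧ ⟦ r′ ⟧ ⟦ k ⟧)))
      (≋-trans (*-cong-≋ ⟦r⟧⟦r′⟧≋1 (≋-refl {⟦ k ⟧}))
      (≡⇒≋ (ℤ.*-identityˡ ⟦ k ⟧)))))
  operation-phase⁻¹ {s} {s′} (modulate l eq) = modulate-phase (- ⟦ l ⟧) λ k → begin
    s k
      ≈⟨ cancel-unimodular (^ᶻ-unimodular (+ 2 * ⟦ l ⟧ * ⟦ k ⟧))
           (≈-trans (eq k) (*-congʳ (W^ⁿ (toℕ l) (toℕ k)))) ⟩
    conj (ζ ^ᶻ (+ 2 * ⟦ l ⟧ * ⟦ k ⟧)) · s′ k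
      ≈⟨ *-congʳ (conj-^ᶻ R ζ (+ 2 * ⟦ l ⟧ * ⟦ k ⟧)) ⟩
    ζ ^ᶻ (- (+ 2 * ⟦ l ⟧ * ⟦ k ⟧)) · s′ k
      ≡⟨ cong (λ i → ζ ^ᶻ i · s′ k) (lemma ⟦ l ⟧ ⟦ k ⟧) ⟩
    ζ ^ᶻ (+ 2 * (- ⟦ l ⟧) * ⟦ k ⟧) · s′ k  ∎
    where
    lemma : ∀ l k → - (+ 2 * l * k) ≡ + 2 * (- l) * k
    lemma = solve-∀
  operation-phase⁻¹ {s} (conjugate eq) =
    conjugate-phase (λ k → ≈-trans (≈-sym (conj-involutive (s k))) (conj-cong (≈-sym (eq k))))

  equivalent-phase : Equivalent s s′ → IsQuadraticPhase s → IsQuadraticPhase s′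
  equivalent-phase ε              φ = φ
  equivalent-phase (fwd op ◅ ops) φ = equivalent-phase ops (operation-phase op φ)
  equivalent-phase (bwd op ◅ ops) φ = equivalent-phase ops (operation-phase⁻¹ op φ)

  -- Zadoff-Chu sequences and `y` as powers of ζ with quadratic exponents.

  module _ (u q : ℤ) where
    private
      κ = + (N ℕ.% 2) + + 2 * q

    z-quadratic : ∀ t → z u q t ≈ ζ ^ᶻ quadratic u (u * κ) ⟦ t ⟧
    z-quadratic t = begin
      z u q t                         ≡⟨ cong (ζ ^ᶻ_) (lemma u q (+ (N ℕ.% 2)) ⟦ t ⟧) ⟩
      ζ ^ᶻ quadratic u (u * κ) ⟦ t ⟧  ∎
      where
      lemma : ∀ u q ε t → u * (t + ε + + 2 * q) * t ≡ u * (t * t) + u * (ε + + 2 * q) * t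
      lemma = solve-∀

    -- The remainder of N modulo 2 is congruent to N, and 2q vanishes modulo 2.
    z-parity : u * κ ≋ u * + N [ + 2 ]
    z-parity = *-cong-≋ (≋-refl {u}) (from-∣ (subst (+ 2 ∣_) (lemma (+ (N ℕ.% 2)) (+ N) q)
      (∣m∣n⇒∣m+n (to-∣ (%-≋ N 2)) (∣m⇒∣m*n q ∣-refl))))
      where
      lemma : ∀ ε n q → ε - n + + 2 * q ≡ ε + + 2 * q - n
      lemma = solve-∀

    z-phase : IsQuadraticPhase (z u q)
    z-phase = quadraticPhase 1# u (u * κ) z-parity λ k →
      ≈-trans (z-quadratic k) (≈-sym (*-identityˡ _))

    y-quadratic : ∀ a b k → y u q a b k ≈ ζ ^ᶻ quadratic u (u * κ) (quadratic ⟦ a ⟧ ⟦ b ⟧ ⟦ k ⟧)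
    y-quadratic a b k =
      ≈-trans (z-quadratic (π a b k)) (^ᶻ-quadratic-cong u (u * κ) z-parity (⟦π⟧ a b k))

    -- Periodicity of both sides extends the agreement from representatives below N to every natural
    -- n, as third differences reaching n = 4 are taken even when N < 5.
    y-phase⇒quadratic : ∀ a b (φ : IsQuadraticPhase (y u q a b)) n →
      quadratic u (u * κ) (quadratic ⟦ a ⟧ ⟦ b ⟧ (+ n)) ≋
      quadratic (IsQuadraticPhase.a φ) (IsQuadraticPhase.b φ) (+ n) [ + 2 * + N ]
    y-phase⇒quadratic a b (quadraticPhase x A B parity phase) n = ^ᶻ-injective-2N _ _ (begin
      ζ ^ᶻ Q n                       ≈⟨ at n ⟩
      x · ζ ^ᶻ quadratic A B (+ n)   ≈⟨ *-congʳ x≈1 ⟩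
      1# · ζ ^ᶻ quadratic A B (+ n)  ≈⟨ *-identityˡ _ ⟩
      ζ ^ᶻ quadratic A B (+ n)       ∎)
      where
      Q : ℕ → ℤ
      Q n = quadratic u (u * κ) (quadratic ⟦ a ⟧ ⟦ b ⟧ (+ n))
      at : ∀ n → ζ ^ᶻ Q n ≈ x · ζ ^ᶻ quadratic A B (+ n)
      at n = begin
        ζ ^ᶻ Q n
          ≈⟨ ^ᶻ-quadratic-cong u (u * κ) z-parity (quadratic-cong ⟦ a ⟧ ⟦ b ⟧ (⟦mod⟧ n N)) ⟨
        ζ ^ᶻ Q (toℕ (n mod N))              ≈⟨ y-quadratic a b (n mod N) ⟨
        y u q a b (n mod N)                 ≈⟨ phase (n mod N) ⟩
        x · ζ ^ᶻ quadratic A B ⟦ n mod N ⟧  ≈⟨ *-congˡ (^ᶻ-quadratic-cong A B parity (⟦mod⟧ n N)) ⟩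
        x · ζ ^ᶻ quadratic A B (+ n)        ∎
      quadratic-0 : ∀ a b → a * 0ℤ + b * 0ℤ ≡ 0ℤ
      quadratic-0 = solve-∀
      -- Both exponents vanish at 0, which pins down the constant factor.
      x≈1 : x ≈ 1#
      x≈1 = begin
        x                          ≈⟨ *-identityʳ x ⟨
        x · 1#                     ≡⟨ cong (λ i → x · ζ ^ᶻ i) (quadratic-0 A B) ⟨
        x · ζ ^ᶻ quadratic A B 0ℤ  ≈⟨ at 0 ⟨
        ζ ^ᶻ Q 0
          ≡⟨ cong (λ i → ζ ^ᶻ quadratic u (u * κ) i) (quadratic-0 ⟦ a ⟧ ⟦ b ⟧) ⟩
        ζ ^ᶻ quadratic u (u * κ) 0ℤ  ≡⟨ cong (ζ ^ᶻ_) (quadratic-0 u (u * κ)) ⟩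
        1#                           ∎

  -- The exponent of `z a 0ℤ` has linear coefficient a ε. The surplus 2h contributes ζ^(2hk), a
  -- modulation in which h counts only modulo N.
  quadratic-z : ∀ a b h → b - a * + (N ℕ.% 2) ≡ h * + 2 → ∀ k →
    ζ ^ᶻ quadratic a b ⟦ k ⟧ ≈ W ^ⁿ (toℕ (fromℤ N h) ℕ.* toℕ k) · z a 0ℤ k
  quadratic-z a b h b-aε≡2h k = begin
    ζ ^ᶻ quadratic a b ⟦ k ⟧  ≡⟨ cong (ζ ^ᶻ_) (split a b ε₂ ⟦ k ⟧) ⟩
    ζ ^ᶻ ((b - a * ε₂) * ⟦ k ⟧ + Z)
      ≡⟨ cong (λ i → ζ ^ᶻ (i * ⟦ k ⟧ + Z)) b-aε≡2h ⟩
    ζ ^ᶻ (h * + 2 * ⟦ k ⟧ + Z)       ≈⟨ ^ᶻ-+ (h * + 2 * ⟦ k ⟧) Z ⟩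
    ζ ^ᶻ (h * + 2 * ⟦ k ⟧) · ζ ^ᶻ Z  ≈⟨ *-congʳ (^ᶻ-cong-2N 2hk≋) ⟩
    ζ ^ᶻ (+ 2 * ⟦ fromℤ N h ⟧ * ⟦ k ⟧) · ζ ^ᶻ Z
      ≈⟨ *-congʳ (W^ⁿ (toℕ (fromℤ N h)) (toℕ k)) ⟨
    W ^ⁿ (toℕ (fromℤ N h) ℕ.* toℕ k) · z a 0ℤ k  ∎
    where
    ε₂ = + (N ℕ.% 2)
    Z = a * (⟦ k ⟧ + ε₂ + + 2 * 0ℤ) * ⟦ k ⟧
    split : ∀ a b ε k → a * (k * k) + b * k ≡ (b - a * ε) * k + a * (k + ε + + 0) * k
    split = solve-∀
    lemma : ∀ l h k → - (+ 2 * (l - h) * k) ≡ h * + 2 * k - + 2 * l * k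
    lemma = solve-∀
    2hk≋ : h * + 2 * ⟦ k ⟧ ≋ + 2 * ⟦ fromℤ N h ⟧ * ⟦ k ⟧ [ + 2 * + N ]
    2hk≋ = from-∣ (subst (+ 2 * + N ∣_) (lemma ⟦ fromℤ N h ⟧ h ⟦ k ⟧)
      (∣m⇒∣-m (∣m⇒∣m*n ⟦ k ⟧ (*-monoʳ-∣ (+ 2) (to-∣ (⟦fromℤ⟧ N h))))))

  -- The two implications between Zadoff-Chu equivalence and N ∣ 6a.

  module _ (a b : Fin N) (qpp : IsQPP a b) (u q : ℤ) (u-coprime : gcd u (+ N) ≡ 1ℤ) where
    open QPP a b qpp
    private
      A = ⟦ a ⟧
      B = ⟦ b ⟧
      κ = + (N ℕ.% 2) + + 2 * q
      u-coprime′ : ℕ.Coprime ℤ.∣ u ∣ N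
      u-coprime′ = ℕ.gcd≡1⇒coprime (ℤ.+-injective u-coprime)

    -- The exponents agree modulo 2N, so 2N divides 12 u a (a + b); a factor 2 cancels.
    phase⇒∣6ua[a+b] : IsQuadraticPhase (y u q a b) → + N ∣ u * ((A + B) * (+ 6 * A))
    phase⇒∣6ua[a+b] φ = *-cancelˡ-∣ (+ 2) (subst (+ 2 * + N ∣_) (lemma u A B)
      (∣12ua[a+b] u κ A B (IsQuadraticPhase.a φ) (IsQuadraticPhase.b φ)
        (y-phase⇒quadratic u q a b φ)))
      where
      lemma : ∀ u a b → + 12 * (u * ((a + b) * a)) ≡ + 2 * (u * ((a + b) * (+ 6 * a)))
      lemma = solve-∀

    ZC⇒∣6a : IsZCEquivalent (y u q a b) → N ℕ.∣ 6 ℕ.* toℕ a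
    ZC⇒∣6a (u′ , q′ , _ , z~y) =
      subst (N ℕ.∣_) (ℤ.abs-* (+ 6) A)
        -- First u is cancelled, then a + b; both are prime to N.
        (ℤ.coprime-divisor (+ N) (A + B) (+ 6 * A) (ℕ.sym a+b-coprime)
        (ℤ.coprime-divisor (+ N) u ((A + B) * (+ 6 * A)) (ℕ.sym u-coprime′)
        (∣⇒∣ᵤ (phase⇒∣6ua[a+b] (equivalent-phase z~y (z-phase u′ q′))))))

    private
      ε₂ = + (N ℕ.% 2)
      -- `U` and `V` are the coefficients to which `quadratic-∘-quadratic` reduces the exponent of
      -- `y`.
      U = u * (A * A + B * B + κ * A)
      V = u * (+ 2 * (A * B) + κ * B)

    leading-coprime : N ℕ.∣ 6 ℕ.* toℕ a → gcd U (+ N) ≡ 1ℤ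
    leading-coprime N∣6a = cong +_ (ℕ.coprime⇒gcd≡1 (no-common-prime⇒coprime ℤ.∣ U ∣ N common))
      where
      common : ∀ p → Prime p → p ℕ.∣ ℤ.∣ U ∣ → ¬ p ℕ.∣ N
      common p p-prime p∣U p∣N with euclid p-prime u (A * A + B * B + κ * A) (∣ᵤ⇒∣ p∣U)
      ... | inj₁ p∣u = ¬prime[1] (subst Prime (u-coprime′ (∣⇒∣ᵤ p∣u , p∣N)) p-prime)
      ... | inj₂ p∣L = prime∤leading N∣6a q p-prime p∣N p∣L

    -- As x² ≡ x modulo 2, both V and U ε reduce to u ε b.
    modulation-even : + 2 ∣ V - U * ε₂
    modulation-even = subst (+ 2 ∣_) (lemma u A B ε₂ q) (∣n⇒∣m*n u (∣m∣n⇒∣m-n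
      (∣m⇒∣m*n (A * B + q * B - ε₂ * q * A + ε₂ * A + ε₂ * B) ∣-refl)
      (∣m∣n⇒∣m+n (∣m∣n⇒∣m+n (∣n⇒∣m*n ε₂ (2∣i²+i A)) (∣n⇒∣m*n ε₂ (2∣i²+i B)))
                 (∣n⇒∣m*n A (2∣i²+i ε₂)))))
      where
      lemma : ∀ u a b ε q →
        u * ((+ 2 * (a * b + q * b - ε * q * a + ε * a + ε * b)) -
             (ε * (a * a + a) + ε * (b * b + b) + a * (ε * ε + ε))) ≡
        u * (+ 2 * (a * b) + (ε + + 2 * q) * b) - u * (a * a + b * b + (ε + + 2 * q) * a) * ε
      lemma = solve-∀

    -- A single modulation, by h = (V - U ε) / 2 reduced modulo N, takes `z U 0ℤ` to `y`.
    ∣6a⇒ZC : N ℕ.∣ 6 ℕ.* toℕ a → IsZCEquivalent (y u q a b)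
    ∣6a⇒ZC N∣6a = U , 0ℤ , leading-coprime N∣6a , fwd (modulate (fromℤ N h) λ k →
      ≈-trans (y-quadratic u q a b k)
        (≈-trans (^ᶻ-cong-2N (quadratic-∘-quadratic u κ A B (toℕ k) N∣6a′))
               (quadratic-z U V h (_∣_.equality modulation-even) k))) ◅ ε
      where
      h = _∣_.quotient modulation-even
      N∣6a′ : + N ∣ + 6 * A
      N∣6a′ = subst (+ N ∣_) (ℤ.pos-* 6 (toℕ a)) (∣ᵤ⇒∣ N∣6a)

theorem1 :
  ∀ {c ℓ} (R : InvolutiveRing c ℓ) (N : ℕ) .{{_ : NonZero N}} → 3 ≤ N →
  let open InvolutiveRing R in
  (ζ : Carrier) → Unimodular ζ → IsPrimitiveRoot (2 ℕ.* N) ζ →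
  let open ZadoffChu R N ζ in
  (a b : Fin N) → IsQPP a b →
  (u q : ℤ) → gcd u (+ N) ≡ 1ℤ →
  IsZCEquivalent (y u q a b) ⇔
    (∀ p α (p-prime : Prime p) → p ℕ.∣ N → p ^ α ∥ N →
      Valuation≥ p-prime α a (η p α))
theorem1 R N _ ζ ζζ̄≈1 ζ-primitive a b qpp u q u-coprime = mk⇔
  (λ zc → ∣6a⇒valuations a (ZC⇒∣6a a b qpp u q u-coprime zc))
  (λ valuations → ∣6a⇒ZC a b qpp u q u-coprime (valuations⇒∣6a a valuations))
  where open QuadraticPhases R N ζ ζζ̄≈1 ζ-primitive
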